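{- Let $N\in\{U,C,I,T,S\}$ and let $\mathcal{Y}_N\in\{NS,\ \leq_N^{l},\ \leq_N^{l\supseteq},\ \leq_N^{lf},\ \leq_N^{lf\supseteq},\ D_N\}$. The logical preorder induced by the logic $\mathcal{L}'_{\mathcal{Y}_N}$ coincides on image-finite processes with the corresponding observational preorder. That is, for all image-finite processes $p,q$: 1. $p\sqsubseteq_{\mathcal{L}'_{NS}}q \iff BGO_N(p)\subseteq BGO_N(q)$; 2. $p\sqsubseteq_{\mathcal{L}'_{Z}}q \iff p\, Z\, q$ for each $Z\in\{\leq_N^{l},\leq_N^{l\supseteq},\leq_N^{lf},\leq_N^{lf\supseteq}\}$; 3. $p\sqsubseteq_{\mathcal{L}'_{D_N}}q \iff dBGO_N(p)\subseteq dBGO_N(q)$.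
   Context: **Processes and formulas.** Processes are states of a labelled transition system with action set $Act$ and transitions $p\xrightarrow{a}p'$. A process is image-finite if every state reachable from it has finitely many $a$-successors, for each $a\in Act$. Hennessy-Milner formulas: $\varphi::=\bigwedge_{i\in I}\varphi_i\mid a\varphi\mid\neg\varphi$ ($I$ an arbitrary index set, $a\in Act$), where $p\models a\varphi$ iff $p\xrightarrow{a}q$ and $q\models\varphi$ for some $q$, and conjunction and negation have their usual meaning. $\top$ is the empty conjunction, $\wedge$ is binary conjunction, and $0$ abbreviates $\bigwedge_{a\in Act}\neg a\top$. For a set of formulas $\mathcal{L}$: $p\sqsubseteq_{\mathcal{L}}q$ iff for all $\varphi\in\mathcal{L}$, $p\models\varphi$ implies $q\models\varphi$. Every logic below is the least set closed under the given clauses. **Constraint logics.** $\mathcal{L}'_U=\{\top\}$; $\mathcal{L}'_C=\{\top,\neg 0\}$; $\mathcal{L}'_I=\{\top,\neg 0\}\cup\{a\top\mid a\in Act\}$; $\mathcal{L}'_T$: $\top\in\mathcal{L}'_T$, and $\varphi\in\mathcal{L}'_T,a\in Act\Rightarrow a\varphi\in\mathcal{L}'_T$; $\mathcal{L}'_S$: closed under prefixes $a\varphi$ and arbitrary conjunctions. The symmetric closure $\mathcal{L}_N^{\equiv}$ contains $\sigma$ and $\neg\sigma$ for each $\sigma\in\mathcal{L}'_N$ and is closed under arbitrary conjunctions. The negative closure $\mathcal{L}_N^{\neg}$ contains $\neg\sigma$ for each $\sigma\in\mathcal{L}'_N$ and is closed under arbitrary conjunctions. **Logics of the semantics.** - $\mathcal{L}'_{NS}$: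 $\sigma\in\mathcal{L}'_N\Rightarrow\sigma,\neg\sigma\in\mathcal{L}'_{NS}$; closed under arbitrary conjunctions and prefixes $a\varphi$. - $\mathcal{L}'_{\leq_N^{l}}$: contains $\top$; $\varphi\in\mathcal{L}'_{\leq_N^{l}},\sigma\in\mathcal{L}_N^{\equiv}\Rightarrow\sigma\wedge\varphi\in\mathcal{L}'_{\leq_N^{l}}$; closed under prefixes. - $\mathcal{L}'_{\leq_N^{l\supseteq}}$: the same with $\mathcal{L}_N^{\neg}$ in place of $\mathcal{L}_N^{\equiv}$. - $\mathcal{L}'_{\leq_N^{lf}}$: contains $\top$ and every $\sigma\in\mathcal{L}_N^{\equiv}$; closed under prefixes. - $\mathcal{L}'_{\leq_N^{lf\supseteq}}$: contains $\top$ and every $\sigma\in\mathcal{L}_N^{\neg}$; closed under prefixes. - $\mathcal{L}'_{D_N}$: contains $\top$; $\varphi\in\mathcal{L}'_{D_N},\sigma\in\mathcal{L}_N^{\equiv}\Rightarrow\sigma\wedge\varphi\in\mathcal{L}'_{D_N}$; if $X\subseteq Act$ and $\varphi_a\in\mathcal{L}'_{D_N}$ for all $a\in X$, then $\bigwedge_{a\in X}a\varphi_a\in\mathcal{L}'_{D_N}$. **Local observations.** $L_U(p)=\cdot$ (a single value); $L_C(p)\in\{\text{true},\text{false}\}$ is true iff $p$ has no transitions; $L_I(p)=I(p)=\{a\in Act\mid p\xrightarrow{a}\}$; $L_T(p)$ is the set of finite traces of $p$; $L_S(p)$ is the class of $p$ under simulation equivalence (mutual similarity). Comparison of local observations: $L_N(p)\supseteq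 L_N(q)$ always holds for $N=U$; for $N=C$ it means that if $q$ has a transition then $p$ has a transition; for $N=I,T$ it is set inclusion; for $N=S$ it means that $q$ is simulated by $p$. **Observations.** $BGO_N$ is the set of finite trees $\langle l,\{(a_i,bgo_i)\mid i\in 1..n\}\rangle$ with $n\ge 0$, $l$ a local observation, $a_i\in Act$, $bgo_i\in BGO_N$. Recursively, $BGO_N(p)$ consists of the $\langle L_N(p),S\rangle$ with $S$ a finite subset of $\{(a,bgo)\mid p\xrightarrow{a}p',\ bgo\in BGO_N(p')\}$. $dBGO_N(p)$ is the set of trees in $BGO_N(p)$ in which, at every node, the outgoing arcs are labelled by pairwise distinct actions. $LGO_N(p)$ is the set of trees in $BGO_N(p)$ in which each node has at most one outgoing arc; such trees are written as sequences $X_0a_1X_1\ldots a_nX_n$, that is, $X_i=L_N(p_i)$ for some $p=p_0\xrightarrow{a_1}p_1\cdots\xrightarrow{a_n}p_n$. **Linear orders.** $p\leq_N^{l}q$ iff $LGO_N(p)\subseteq LGO_N(q)$. The other three orders require: for every $X_0a_1X_1\ldots X_n\in LGO_N(p)$ there is $Y_0a_1Y_1\ldots Y_n\in LGO_N(q)$ (same actions) such that: $X_i\supseteq Y_i$ for all $i\in 0..n$ (for $\leq_N^{l\supseteq}$); $X_n=Y_n$ (for $\leq_N^{lf}$); $X_n\supseteq Y_n$ (for $\leq_N^{lf\supseteq}$). -}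

module Defs where

open import Data.Bool.Base using (Bool; if_then_else_)
open import Data.Empty.Polymorphic using (⊥)
open import Data.List.Base using (List; []; _∷_; map)
open import Data.List.Membership.Propositional using () renaming (_∈_ to _∈ˡ_)
open import Data.List.Relation.Unary.All using (All)
open import Data.List.Relation.Unary.Unique.Propositional using (Unique)
open import Data.Product.Base using (Σ; ∃; _×_; _,_; proj₁; proj₂)
open import Function.Bundles using (_⇔_)
open import Level using (Level; suc; Lift; lower)
open import Relation.Binary.Construct.Closure.ReflexiveTransitive using (Star)
open import Relation.Binary.Core using (Rel)
open import Relation.Nullary.Negation.Core using () renaming (¬_ to Not_)
open import Relation.Unary using (Pred; _∈_; _⊆_; _≐_)

record LTS (ℓ : Level) : Set (suc ℓ) where
  field
    Act     : Set ℓ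
    Proc    : Set ℓ
    _-[_]→_ : Proc → Act → Proc → Set ℓ

data Constraint : Set where
  U C I T S : Constraint

module HennessyMilner {ℓ : Level} (Act : Set ℓ) where

  infix  8 ¬_
  infixr 8 _·_
  infixr 6 _∧_

  data Form : Set (suc ℓ) where
    ⋀   : {J : Set ℓ} → (J → Form) → Form
    _·_ : Act → Form → Form
    ¬_  : Form → Form

  ⊤ : Form
  ⊤ = ⋀ {J = ⊥} λ ()

  _∧_ : Form → Form → Form
  φ ∧ ψ = ⋀ {J = Lift ℓ Bool} λ b → if lower b then φ else ψ

  𝟎 : Form
  𝟎 = ⋀ λ (a : Act) → ¬ (a · ⊤)

  Logic : Set (suc (suc ℓ))
  Logic = Pred Form (suc ℓ)

  data 𝓛 : Constraint → Logic where
    U-⊤  : 𝓛 U ⊤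
    C-⊤  : 𝓛 C ⊤
    C-¬𝟎 : 𝓛 C (¬ 𝟎)
    I-⊤  : 𝓛 I ⊤
    I-¬𝟎 : 𝓛 I (¬ 𝟎)
    I-·  : (a : Act) → 𝓛 I (a · ⊤)
    T-⊤  : 𝓛 T ⊤
    T-·  : (a : Act) {φ : Form} → 𝓛 T φ → 𝓛 T (a · φ)
    S-·  : (a : Act) {φ : Form} → 𝓛 S φ → 𝓛 S (a · φ)
    S-⋀  : {J : Set ℓ} {φ : J → Form} → (∀ j → 𝓛 S (φ j)) → 𝓛 S (⋀ φ)

  data 𝓛≡ (N : Constraint) : Logic where
    pos : {σ : Form} → 𝓛 N σ → 𝓛≡ N σ
    neg : {σ : Form} → 𝓛 N σ → 𝓛≡ N (¬ σ)
    and : {J : Set ℓ} {φ : J → Form} → (∀ j → 𝓛≡ N (φ j)) → 𝓛≡ N (⋀ φ)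

  data 𝓛¬ (N : Constraint) : Logic where
    neg : {σ : Form} → 𝓛 N σ → 𝓛¬ N (¬ σ)
    and : {J : Set ℓ} {φ : J → Form} → (∀ j → 𝓛¬ N (φ j)) → 𝓛¬ N (⋀ φ)

  data 𝓛-NS (N : Constraint) : Logic where
    pos    : {σ : Form} → 𝓛 N σ → 𝓛-NS N σ
    neg    : {σ : Form} → 𝓛 N σ → 𝓛-NS N (¬ σ)
    and    : {J : Set ℓ} {φ : J → Form} →
             (∀ j → 𝓛-NS N (φ j)) → 𝓛-NS N (⋀ φ)
    prefix : (a : Act) {φ : Form} → 𝓛-NS N φ → 𝓛-NS N (a · φ)

  data Local (K : Logic) : Logic where
    top    : Local K ⊤
    local  : {σ φ : Form} → K σ → Local K φ → Local K (σ ∧ φ)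
    prefix : (a : Act) {φ : Form} → Local K φ → Local K (a · φ)

  data Final (K : Logic) : Logic where
    top    : Final K ⊤
    final  : {σ : Form} → K σ → Final K σ
    prefix : (a : Act) {φ : Form} → Final K φ → Final K (a · φ)

  𝓛-l 𝓛-l⊇ 𝓛-lf 𝓛-lf⊇ : Constraint → Logic
  𝓛-l   N = Local (𝓛≡ N)
  𝓛-l⊇  N = Local (𝓛¬ N)
  𝓛-lf  N = Final (𝓛≡ N)
  𝓛-lf⊇ N = Final (𝓛¬ N)

  -- In `branch`, φ is indexed by actions rather than by elements of Σ Act X:
  -- X need not be proof-irrelevant, and each action in X must get one formula.
  -- The values of φ outside X play no role.
  data 𝓛-D (N : Constraint) : Logic where
    top    : 𝓛-D N ⊤
    local  : {σ φ : Form} → 𝓛≡ N σ → 𝓛-D N φ → 𝓛-D N (σ ∧ φ)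
    branch : (X : Pred Act ℓ) (φ : Act → Form) →
             (∀ a → a ∈ X → 𝓛-D N (φ a)) →
             𝓛-D N (⋀ {J = Σ Act X} λ x → proj₁ x · φ (proj₁ x))

module Semantics {ℓ : Level} (lts : LTS ℓ) where

  open LTS lts public
  open HennessyMilner Act public

  Step : Rel Proc ℓ
  Step p q = ∃ λ a → p -[ a ]→ q

  ImageFinite : Pred Proc ℓ
  ImageFinite p = ∀ {r} → Star Step p r → ∀ a →
    ∃ λ (qs : List Proc) → ∀ q → (r -[ a ]→ q) ⇔ (q ∈ˡ qs)

  infix 4 _⊨_ _⊑[_]_ _≲_ _≈_ _⊒_

  _⊨_ : Proc → Form → Set ℓ
  p ⊨ ⋀ φ     = ∀ j → p ⊨ φ j
  p ⊨ (a · φ) = ∃ λ q → p -[ a ]→ q × q ⊨ φ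
  p ⊨ (¬ φ)   = Not (p ⊨ φ)

  _⊑[_]_ : Proc → Logic → Proc → Set (suc ℓ)
  p ⊑[ K ] q = ∀ {φ} → φ ∈ K → p ⊨ φ → q ⊨ φ

  Deadlocked : Pred Proc ℓ
  Deadlocked p = ∀ a q → Not (p -[ a ]→ q)

  Initial : Proc → Pred Act ℓ
  Initial p a = ∃ λ q → p -[ a ]→ q

  data Trace : Proc → Pred (List Act) ℓ where
    []  : ∀ {p} → Trace p []
    _∷_ : ∀ {p q a w} → p -[ a ]→ q → Trace q w → Trace p (a ∷ w)

  Simulation : Pred (Rel Proc ℓ) ℓ
  Simulation R = ∀ {p q} → R p q →
    ∀ {a p′} → p -[ a ]→ p′ → ∃ λ q′ → q -[ a ]→ q′ × R p′ q′

  _≲_ : Rel Proc (suc ℓ)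
  p ≲ q = ∃ λ (R : Rel Proc ℓ) → Simulation R × R p q

  -- Values of local observations, to be compared by _≈_ rather than _≡_.
  -- Truth values are propositions, taken up to logical equivalence; classes
  -- under simulation equivalence are given by a representative.
  data LocalObs : Constraint → Set (suc ℓ) where
    ∙       : LocalObs U
    truth   : Set ℓ → LocalObs C
    actions : Pred Act ℓ → LocalObs I
    traces  : Pred (List Act) ℓ → LocalObs T
    class   : Proc → LocalObs S

  L : (N : Constraint) → Proc → LocalObs N
  L U p = ∙
  L C p = truth (Deadlocked p)
  L I p = actions (Initial p)
  L T p = traces (Trace p)
  L S p = class p

  data _≈_ : {N : Constraint} → Rel (LocalObs N) (suc ℓ) where
    ∙       : ∙ ≈ ∙
    truth   : ∀ {P Q} → P ⇔ Q → truth P ≈ truth Q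
    actions : ∀ {A B} → A ≐ B → actions A ≈ actions B
    traces  : ∀ {A B} → A ≐ B → traces A ≈ traces B
    class   : ∀ {p q} → p ≲ q → q ≲ p → class p ≈ class q

  data _⊒_ : {N : Constraint} → Rel (LocalObs N) (suc ℓ) where
    ∙       : ∙ ⊒ ∙
    truth   : ∀ {P Q} → (Not Q → Not P) → truth P ⊒ truth Q
    actions : ∀ {A B} → B ⊆ A → actions A ⊒ actions B
    traces  : ∀ {A B} → B ⊆ A → traces A ⊒ traces B
    class   : ∀ {p q} → q ≲ p → class p ⊒ class q

  -- The list of arcs stands for the finite set of its elements.
  data Tree (N : Constraint) : Set (suc ℓ) where
    node : LocalObs N → List (Act × Tree N) → Tree N

  data BGO (N : Constraint) : Proc → Pred (Tree N) (suc ℓ) where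
    node : ∀ {p l arcs} → l ≈ L N p →
           All (λ arc → ∃ λ p′ → p -[ proj₁ arc ]→ p′ × proj₂ arc ∈ BGO N p′) arcs →
           node l arcs ∈ BGO N p

  -- `Unique` also excludes repeated arcs; this loses no set of arcs, since
  -- every finite set has a list representation without repetitions.
  data Deterministic {N : Constraint} : Pred (Tree N) (suc ℓ) where
    node : ∀ {l arcs} → Unique (map proj₁ arcs) →
           All (λ arc → proj₂ arc ∈ Deterministic) arcs →
           node l arcs ∈ Deterministic

  dBGO : (N : Constraint) → Proc → Pred (Tree N) (suc ℓ)
  dBGO N p t = t ∈ BGO N p × t ∈ Deterministic

  -- X₀ a₁ X₁ … aₙ Xₙ
  data Sequence (N : Constraint) : Set (suc ℓ) where
    ⟨_⟩    : LocalObs N → Sequence N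
    _▷_▷_ : LocalObs N → Act → Sequence N → Sequence N

  -- Up to repetition of arcs, the trees `tree s` are exactly those in which
  -- each node has at most one outgoing arc.
  tree : ∀ {N} → Sequence N → Tree N
  tree ⟨ X ⟩       = node X []
  tree (X ▷ a ▷ s) = node X ((a , tree s) ∷ [])

  LGO : (N : Constraint) → Proc → Pred (Sequence N) (suc ℓ)
  LGO N p s = tree s ∈ BGO N p

  data AtAll {N : Constraint} (R : Rel (LocalObs N) (suc ℓ)) : Rel (Sequence N) (suc ℓ) where
    ⟨_⟩   : ∀ {X Y} → R X Y → AtAll R ⟨ X ⟩ ⟨ Y ⟩
    _▷_▷_ : ∀ {X Y s t} → R X Y → ∀ a → AtAll R s t → AtAll R (X ▷ a ▷ s) (Y ▷ a ▷ t)

  data AtEnd {N : Constraint} (R : Rel (LocalObs N) (suc ℓ)) : Rel (Sequence N) (suc ℓ) where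
    ⟨_⟩ : ∀ {X Y} → R X Y → AtEnd R ⟨ X ⟩ ⟨ Y ⟩
    _▷_ : ∀ {X Y s t} a → AtEnd R s t → AtEnd R (X ▷ a ▷ s) (Y ▷ a ▷ t)

  infix 4 _≤l[_]_ _≤l⊇[_]_ _≤lf[_]_ _≤lf⊇[_]_

  _≤l[_]_ _≤l⊇[_]_ _≤lf[_]_ _≤lf⊇[_]_ : Proc → Constraint → Proc → Set (suc ℓ)
  p ≤l[ N ] q   = LGO N p ⊆ LGO N q
  p ≤l⊇[ N ] q  = ∀ {s} → s ∈ LGO N p → ∃ λ t → t ∈ LGO N q × AtAll _⊒_ s t
  p ≤lf[ N ] q  = ∀ {s} → s ∈ LGO N p → ∃ λ t → t ∈ LGO N q × AtEnd _≈_ s t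
  p ≤lf⊇[ N ] q = ∀ {s} → s ∈ LGO N p → ∃ λ t → t ∈ LGO N q × AtEnd _⊒_ s t

{-# OPTIONS --safe #-}
-- Every semantics here is an instance of one scheme, in which K is a logic, O p
-- is the set of observations of p, and M q is the set of those q can match.
-- Each s in O p is expressed by a formula of K that p satisfies and that forces
-- M q to contain s; the characteristic formula of a local observation is a
-- conjunction, over all processes, of formulas distinguishing p from them.
-- Conversely, if p satisfies φ then for every finite list of image-finite
-- processes some s in O p is matched only by those members of the list that
-- satisfy φ. Allowing a finite list makes this provable by induction on φ:
-- a prefix replaces the list by the finite list of its successors, and on a
-- finite list an infinite conjunction agrees with a finite subconjunction.
module Submission where

open import Defs
open import Axiom.ExcludedMiddle using (ExcludedMiddle)
open import Data.Bool.Base using (true; false)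
open import Data.List.Base using (List; []; _∷_; _++_; map; deduplicate)
open import Data.List.Membership.Propositional using () renaming (_∈_ to _∈ˡ_)
open import Data.List.Membership.Propositional.Properties
  using (∈-map⁺; ∈-map⁻; ∈-++⁺ˡ; ∈-++⁻; ∈-++⁺ʳ; ∈-deduplicate⁺; ∈-deduplicate⁻)
open import Data.List.Properties using (map-∘; map-id)
open import Data.List.Relation.Unary.All as All using (All; []; _∷_)
import Data.List.Relation.Unary.All.Properties as All
open import Data.List.Relation.Unary.AllPairs using ([]; _∷_)
open import Data.List.Relation.Unary.Any using (here; there)
open import Data.List.Relation.Unary.Unique.Propositional using (Unique)
open import Data.List.Relation.Unary.Unique.DecPropositional.Properties using (deduplicate-!)
open import Data.Product.Base using (Σ; ∃; _×_; _,_; proj₁; proj₂; swap)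
open import Data.Sum.Base using (inj₁; inj₂)
open import Function.Base using (id; _∘_)
open import Function.Bundles using (_⇔_; mk⇔; Equivalence)
open import Function.Construct.Composition using (_⇔-∘_)
open import Level using (Level; Lift; lift; lower; suc)
open import Relation.Binary.Construct.Closure.ReflexiveTransitive using (ε; _◅_)
open import Relation.Binary.Core using (Rel)
open import Relation.Binary.PropositionalEquality using (_≡_; refl; sym; trans; subst)
open import Relation.Nullary.Decidable using (Dec; yes; no; True; toWitness; fromWitness; decidable-stable)
open import Relation.Nullary.Negation.Core using (contradiction) renaming (¬_ to Not_)
open import Relation.Unary using (Pred; _∈_; _⊆_)

open Equivalence using (to; from)

module Coincidence (em : ∀ {a : Level} → ExcludedMiddle a) {ℓ : Level} (lts : LTS ℓ) where

  open Semantics lts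

  -- Classical logic and characteristic formulas.

  byContradiction : ∀ {a} {P : Set a} → Not Not P → P
  byContradiction = decidable-stable em

  ¬∀⇒∃¬ : ∀ {a b} {A : Set a} {P : Pred A b} → Not (∀ x → P x) → ∃ λ x → Not P x
  ¬∀⇒∃¬ ¬∀ = byContradiction λ ¬∃ → ¬∀ λ x → byContradiction λ ¬p → ¬∃ (x , ¬p)

  distinguish : ∀ (K : Logic) {p q} → Not (p ⊑[ K ] q) →
                ∃ λ φ → K φ × p ⊨ φ × Not (q ⊨ φ)
  distinguish K ¬p⊑q = byContradiction λ none →
    ¬p⊑q λ φ∈K p⊨φ → byContradiction λ q⊭φ → none (_ , φ∈K , p⊨φ , q⊭φ)

  ∧-intro : ∀ {p φ ψ} → p ⊨ φ → p ⊨ ψ → p ⊨ φ ∧ ψ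
  ∧-intro p⊨φ p⊨ψ (lift true)  = p⊨φ
  ∧-intro p⊨φ p⊨ψ (lift false) = p⊨ψ

  Conjunctive : Logic → Set _
  Conjunctive K = ∀ {J : Set ℓ} {φ : J → Form} → (∀ j → K (φ j)) → K (⋀ φ)

  -- A conjunction of all formulas of K true at p would be too large for an
  -- index type in Set ℓ; one distinguishing formula per process suffices.
  characteristic : ∀ {K : Logic} → Conjunctive K → ∀ p →
                   ∃ λ χ → K χ × p ⊨ χ × (∀ {r} → r ⊨ χ → p ⊑[ K ] r)
  characteristic {K} conj p =
      (⋀ λ r → proj₁ (separate r))
    , conj (λ r → proj₁ (proj₂ (separate r)))
    , (λ r → proj₁ (proj₂ (proj₂ (separate r))))
    , λ {r} r⊨χ → proj₂ (proj₂ (proj₂ (separate r))) (r⊨χ r)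
    where
    separate : ∀ r → ∃ λ φ → K φ × p ⊨ φ × (r ⊨ φ → p ⊑[ K ] r)
    separate r with em {P = p ⊑[ K ] r}
    ... | yes p⊑r = ⊤ , conj (λ ()) , (λ ()) , λ _ → p⊑r
    ... | no ¬p⊑r = let φ , φ∈K , p⊨φ , r⊭φ = distinguish K ¬p⊑r in
                    φ , φ∈K , p⊨φ , λ r⊨φ → contradiction r⊨φ r⊭φ

  -- Local observations

  ≲⇒⊑ : ∀ {p q} → p ≲ q → p ⊑[ 𝓛 S ] q
  ≲⇒⊑ (R , sim , pRq) (S-· a φ∈S) (p′ , p→p′ , p′⊨φ) =
    let q′ , q→q′ , p′Rq′ = sim pRq p→p′ in
    q′ , q→q′ , ≲⇒⊑ (R , sim , p′Rq′) φ∈S p′⊨φ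
  ≲⇒⊑ p≲q (S-⋀ φ∈S) p⊨φ j = ≲⇒⊑ p≲q (φ∈S j) (p⊨φ j)

  -- The logical preorder is itself a simulation. If no `a`-successor of `q` matched `p′`, each
  -- would falsify some formula of `𝓛 S` true at `p′`; prefixing the conjunction of these by `a`
  -- gives a formula true at `p` but not at `q`.
  ⊑⇒≲ : ∀ {p q} → p ⊑[ 𝓛 S ] q → p ≲ q
  ⊑⇒≲ p⊑q = R , (λ pRq → sim (toWitness (lower pRq))) , intro p⊑q
    where
    -- Excluded middle brings _⊑[ 𝓛 S ]_ down to the level of _≲_'s witnesses.
    R : Rel Proc ℓ
    R p q = Lift ℓ (True (em {P = p ⊑[ 𝓛 S ] q}))

    intro : ∀ {p q} → p ⊑[ 𝓛 S ] q → R p q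
    intro p⊑q = lift (fromWitness λ {φ} → p⊑q {φ})

    sim : ∀ {p q} → p ⊑[ 𝓛 S ] q → ∀ {a p′} → p -[ a ]→ p′ →
          ∃ λ q′ → q -[ a ]→ q′ × R p′ q′
    sim {p} {q} p⊑q {a} {p′} p→p′ = byContradiction λ none →
      let δ : ((q′ , _) : Σ Proc (q -[ a ]→_)) → ∃ λ φ → 𝓛 S φ × p′ ⊨ φ × Not (q′ ⊨ φ)
          δ (q′ , q→q′) = distinguish (𝓛 S) λ p′⊑q′ →
            none (q′ , q→q′ , intro p′⊑q′)
          q′ , q→q′ , q′⊨ = p⊑q (S-· a (S-⋀ λ x → proj₁ (proj₂ (δ x))))
                                (p′ , p→p′ , λ x → proj₁ (proj₂ (proj₂ (δ x))))
      in proj₂ (proj₂ (proj₂ (δ (q′ , q→q′)))) (q′⊨ (q′ , q→q′))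

  ¬𝟎⇒¬Deadlocked : ∀ {p} → p ⊨ ¬ 𝟎 → Not Deadlocked p
  ¬𝟎⇒¬Deadlocked p⊨¬𝟎 dead = p⊨¬𝟎 λ a (q , p→q , _) → dead a q p→q

  ¬Deadlocked⇒¬𝟎 : ∀ {p} → Not Deadlocked p → p ⊨ ¬ 𝟎
  ¬Deadlocked⇒¬𝟎 ¬dead p⊨𝟎 = ¬dead λ a q p→q → p⊨𝟎 a (q , p→q , λ ())

  ⟦_⟧ : List Act → Form
  ⟦ [] ⟧    = ⊤
  ⟦ a ∷ w ⟧ = a · ⟦ w ⟧

  ⟦⟧∈𝓛T : ∀ w → 𝓛 T ⟦ w ⟧
  ⟦⟧∈𝓛T []      = T-⊤
  ⟦⟧∈𝓛T (a ∷ w) = T-· a (⟦⟧∈𝓛T w)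

  Trace⇒⟦⟧ : ∀ {p w} → Trace p w → p ⊨ ⟦ w ⟧
  Trace⇒⟦⟧ []        = λ ()
  Trace⇒⟦⟧ (p→q ∷ t) = _ , p→q , Trace⇒⟦⟧ t

  ⟦⟧⇒Trace : ∀ {p} w → p ⊨ ⟦ w ⟧ → Trace p w
  ⟦⟧⇒Trace []      _               = []
  ⟦⟧⇒Trace (a ∷ w) (_ , p→q , q⊨w) = p→q ∷ ⟦⟧⇒Trace w q⊨w

  𝓛T⇒⟦⟧ : ∀ {φ} → 𝓛 T φ → ∃ λ w → φ ≡ ⟦ w ⟧
  𝓛T⇒⟦⟧ T-⊤ = [] , refl
  𝓛T⇒⟦⟧ (T-· a φ∈T) with 𝓛T⇒⟦⟧ φ∈T
  ... | w , refl = a ∷ w , refl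

  -- The formulas of `𝓛 N` assert only what a process can do, so satisfying more of them means
  -- having the larger observation; hence `p` and `r` swap sides. Later proofs use the clauses of
  -- `𝓛 N` only through this equivalence.
  ⊒⇔⊑ : ∀ N {p r} → L N p ⊒ L N r ⇔ r ⊑[ 𝓛 N ] p
  ⊒⇔⊑ U = mk⇔ (λ { ∙ U-⊤ _ () }) (λ _ → ∙)
  ⊒⇔⊑ C {p} {r} = mk⇔ sound λ r⊑p → truth (¬𝟎⇒¬Deadlocked ∘ r⊑p C-¬𝟎 ∘ ¬Deadlocked⇒¬𝟎)
    where
    sound : L C p ⊒ L C r → r ⊑[ 𝓛 C ] p
    sound _         C-⊤  _ = λ ()
    sound (truth f) C-¬𝟎   = ¬Deadlocked⇒¬𝟎 ∘ f ∘ ¬𝟎⇒¬Deadlocked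
  ⊒⇔⊑ I {p} {r} = mk⇔ sound λ r⊑p → actions λ (q , r→q) →
      let q′ , p→q′ , _ = r⊑p (I-· _) (q , r→q , λ ()) in q′ , p→q′
    where
    sound : L I p ⊒ L I r → r ⊑[ 𝓛 I ] p
    sound _           I-⊤ _ = λ ()
    sound (actions f) I-¬𝟎 r⊨¬𝟎 p⊨𝟎 = r⊨¬𝟎 λ a (q , r→q , _) →
      let q′ , p→q′ = f (q , r→q) in p⊨𝟎 a (q′ , p→q′ , λ ())
    sound (actions f) (I-· a) (q , r→q , _) =
      let q′ , p→q′ = f (q , r→q) in q′ , p→q′ , λ ()
  ⊒⇔⊑ T {p} {r} = mk⇔ sound λ r⊑p →
      traces λ {w} → ⟦⟧⇒Trace w ∘ r⊑p (⟦⟧∈𝓛T w) ∘ Trace⇒⟦⟧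
    where
    sound : L T p ⊒ L T r → r ⊑[ 𝓛 T ] p
    sound (traces f) φ∈T with 𝓛T⇒⟦⟧ φ∈T
    ... | w , refl = Trace⇒⟦⟧ ∘ f ∘ ⟦⟧⇒Trace w
  ⊒⇔⊑ S = mk⇔ (λ { (class r≲p) → ≲⇒⊑ r≲p }) (λ r⊑p → class (⊑⇒≲ r⊑p))

  ≈⇒⊒ : ∀ {N} {X Y : LocalObs N} → X ≈ Y → X ⊒ Y
  ≈⇒⊒ ∙                   = ∙
  ≈⇒⊒ (truth P⇔Q)         = truth λ ¬q → ¬q ∘ to P⇔Q
  ≈⇒⊒ (actions (_ , B⊆A)) = actions B⊆A
  ≈⇒⊒ (traces (_ , B⊆A))  = traces B⊆A
  ≈⇒⊒ (class _ q≲p)       = class q≲p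

  ⊒-antisym : ∀ {N} {X Y : LocalObs N} → X ⊒ Y → Y ⊒ X → X ≈ Y
  ⊒-antisym ∙             ∙             = ∙
  ⊒-antisym (truth f)     (truth g)     = truth (mk⇔
    (λ x → byContradiction λ ¬y → f ¬y x) (λ y → byContradiction λ ¬x → g ¬x y))
  ⊒-antisym (actions B⊆A) (actions A⊆B) = actions (A⊆B , B⊆A)
  ⊒-antisym (traces B⊆A)  (traces A⊆B)  = traces (A⊆B , B⊆A)
  ⊒-antisym (class q≲p)   (class p≲q)   = class p≲q q≲p

  ⊒-trans : ∀ {N} {X Y Z : LocalObs N} → X ⊒ Y → Y ⊒ Z → X ⊒ Z
  ⊒-trans ∙             ∙             = ∙
  ⊒-trans (truth f)     (truth g)     = truth (f ∘ g)
  ⊒-trans (actions B⊆A) (actions C⊆B) = actions (B⊆A ∘ C⊆B)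
  ⊒-trans (traces B⊆A)  (traces C⊆B)  = traces (B⊆A ∘ C⊆B)
  ⊒-trans (class q≲p)   (class r≲q)   = class (⊑⇒≲ λ φ∈S → ≲⇒⊑ q≲p φ∈S ∘ ≲⇒⊑ r≲q φ∈S)

  ≈-sym : ∀ {N} {X Y : LocalObs N} → X ≈ Y → Y ≈ X
  ≈-sym ∙                     = ∙
  ≈-sym (truth P⇔Q)           = truth (mk⇔ (from P⇔Q) (to P⇔Q))
  ≈-sym (actions A≐B)         = actions (swap A≐B)
  ≈-sym (traces A≐B)          = traces (swap A≐B)
  ≈-sym (class p≲q q≲p)       = class q≲p p≲q

  ≈-trans : ∀ {N} {X Y Z : LocalObs N} → X ≈ Y → Y ≈ Z → X ≈ Z
  ≈-trans X≈Y Y≈Z = ⊒-antisym (⊒-trans (≈⇒⊒ X≈Y) (≈⇒⊒ Y≈Z))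
                              (⊒-trans (≈⇒⊒ (≈-sym Y≈Z)) (≈⇒⊒ (≈-sym X≈Y)))

  L-refl : ∀ {N p} → L N p ≈ L N p
  L-refl {N} {p} = let p⊒p = from (⊒⇔⊑ N {p} {p}) λ _ → id in ⊒-antisym p⊒p p⊒p

  -- Labels in an observation agree with `L N p` only up to `≈`, so `R` is compared on arbitrary
  -- representatives `X` and `Y`.
  Adequate : (N : Constraint) → Logic → Rel (LocalObs N) (suc ℓ) → Set _
  Adequate N K R = ∀ {p r X Y} → X ≈ L N p → Y ≈ L N r → p ⊑[ K ] r ⇔ R X Y

  -- Negation reverses the preorder of `⊒⇔⊑`: a formula of `𝓛 N` true at `r` but not at `p` would
  -- have its negation transferred from `p` to `r`.
  𝓛¬-adequate : ∀ {N} → Adequate N (𝓛¬ N) _⊒_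
  𝓛¬-adequate {N} {p} {r} X≈p Y≈r = mk⇔ {A = p ⊑[ 𝓛¬ N ] r}
    (λ p⊑r → ⊒-trans (≈⇒⊒ X≈p) (⊒-trans (complete p⊑r) (≈⇒⊒ (≈-sym Y≈r))))
    (λ X⊒Y → sound (⊒-trans (≈⇒⊒ (≈-sym X≈p)) (⊒-trans X⊒Y (≈⇒⊒ Y≈r))))
    where
    complete : p ⊑[ 𝓛¬ N ] r → L N p ⊒ L N r
    complete p⊑r = from (⊒⇔⊑ N {p} {r}) λ σ∈N r⊨σ →
      byContradiction λ p⊭σ → p⊑r (neg σ∈N) p⊭σ r⊨σ

    sound : L N p ⊒ L N r → p ⊑[ 𝓛¬ N ] r
    sound p⊒r (neg σ∈N) p⊭σ   = p⊭σ ∘ to (⊒⇔⊑ N) p⊒r σ∈N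
    sound p⊒r (and φ∈)  p⊨φ j = sound p⊒r (φ∈ j) (p⊨φ j)

  -- The two inclusions are tested separately, one by negated and the other by unnegated formulas of
  -- `𝓛 N`.
  𝓛≡-adequate : ∀ {N} → Adequate N (𝓛≡ N) _≈_
  𝓛≡-adequate {N} {p} {r} X≈p Y≈r = mk⇔ {A = p ⊑[ 𝓛≡ N ] r}
    (λ p⊑r → ≈-trans X≈p (≈-trans (complete p⊑r) (≈-sym Y≈r)))
    (λ X≈Y → sound (≈-trans (≈-sym X≈p) (≈-trans X≈Y Y≈r)))
    where
    complete : p ⊑[ 𝓛≡ N ] r → L N p ≈ L N r
    complete p⊑r = ⊒-antisym
      (from (⊒⇔⊑ N {p} {r}) λ σ∈N r⊨σ →
        byContradiction λ p⊭σ → p⊑r (neg σ∈N) p⊭σ r⊨σ)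
      (from (⊒⇔⊑ N {r} {p}) λ σ∈N → p⊑r (pos σ∈N))

    sound : L N p ≈ L N r → p ⊑[ 𝓛≡ N ] r
    sound p≈r (pos σ∈N)       = to (⊒⇔⊑ N) (≈⇒⊒ (≈-sym p≈r)) σ∈N
    sound p≈r (neg σ∈N) p⊭σ   = p⊭σ ∘ to (⊒⇔⊑ N) (≈⇒⊒ p≈r) σ∈N
    sound p≈r (and φ∈)  p⊨φ j = sound p≈r (φ∈ j) (p⊨φ j)

  -- Observations of image-finite processes

  ImageFinites : List Proc → Set ℓ
  ImageFinites rs = ∀ {r} → r ∈ˡ rs → ImageFinite r

  -- This is where image-finiteness is used. Successors inherit it, since a path from a successor
  -- extends to a path from its predecessor.
  successors : ∀ rs → ImageFinites rs → ∀ a →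
    ∃ λ ss → ImageFinites ss × (∀ {r s} → r ∈ˡ rs → r -[ a ]→ s → s ∈ˡ ss)
  successors []       fin a = [] , (λ ()) , λ ()
  successors (r ∷ rs) fin a
    with fin (here refl) ε a | successors rs (fin ∘ there) a
  ... | qs , ∈qs | ss , finite , complete = qs ++ ss , finite′ , complete′
    where
    finite′ : ImageFinites (qs ++ ss)
    finite′ s∈ with ∈-++⁻ qs s∈
    ... | inj₁ s∈qs = λ path → fin (here refl) ((a , from (∈qs _) s∈qs) ◅ path)
    ... | inj₂ s∈ss = finite s∈ss
    complete′ : ∀ {r′ s} → r′ ∈ˡ r ∷ rs → r′ -[ a ]→ s → s ∈ˡ qs ++ ss
    complete′ (here refl)  r→s = ∈-++⁺ˡ (to (∈qs _) r→s)
    complete′ (there r′∈) r→s = ∈-++⁺ʳ qs (complete r′∈ r→s)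

  -- Each listed process that falsifies the conjunction contributes one conjunct that it falsifies;
  -- the others contribute nothing.
  finiteSubconjunction : ∀ {J : Set ℓ} (φ : J → Form) rs →
    ∃ λ (js : List J) → ∀ {r} → r ∈ˡ rs → (∀ {j} → j ∈ˡ js → r ⊨ φ j) → r ⊨ ⋀ φ
  finiteSubconjunction φ []       = [] , λ ()
  finiteSubconjunction φ (r ∷ rs) with finiteSubconjunction φ rs | em {P = r ⊨ ⋀ φ}
  ... | js , enough | yes r⊨φ = js , λ
    { (here refl) _ → r⊨φ
    ; (there r∈)    → enough r∈ }
  ... | js , enough | no r⊭φ with ¬∀⇒∃¬ r⊭φ
  ...   | j , r⊭φj = j ∷ js , λ
    { (here refl) all → contradiction (all (here refl)) r⊭φj
    ; (there r∈)  all → enough r∈ (all ∘ there) }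

  module _ {o} {Obs : Set o} (O M : Proc → Pred Obs (suc ℓ)) where

    Expressible : Logic → Set _
    Expressible K = ∀ {p s} → s ∈ O p → ∃ λ φ → K φ × p ⊨ φ × (∀ {r} → r ⊨ φ → s ∈ M r)

    Approximable : Form → Set _
    Approximable φ = ∀ {p} → p ⊨ φ → ∀ rs → ImageFinites rs →
      ∃ λ s → s ∈ O p × (∀ {r} → r ∈ˡ rs → s ∈ M r → r ⊨ φ)

    coincide : ∀ {K} → Expressible K → (∀ {φ} → K φ → Approximable φ) →
               ∀ {p q} → ImageFinite q → p ⊑[ K ] q ⇔ O p ⊆ M q
    coincide {K} expressible approximable {p} {q} fin = mk⇔ {A = p ⊑[ K ] q} {B = O p ⊆ M q}
      (λ p⊑q s∈O → let φ , φ∈K , p⊨φ , forces = expressible s∈O in forces (p⊑q φ∈K p⊨φ))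
      (λ O⊆M φ∈K p⊨φ →
        -- Only the process to be tested is listed; longer lists arise inside the induction.
        let s , s∈O , sound = approximable φ∈K p⊨φ (q ∷ []) λ { (here refl) → fin } in
        sound (here refl) (O⊆M s∈O))

  -- Linear semantics

  -- `K` with `R` is instantiated by `𝓛≡` with `≈` and by `𝓛¬` with `⊒`; the choice between
  -- `AllMatch` with `Local` and `EndMatch` with `Final` then yields the four linear orders.
  module Linear {N : Constraint} {K : Logic} {R : Rel (LocalObs N) (suc ℓ)}
                (conj : Conjunctive K) (adequate : Adequate N K R) where

    AllMatch EndMatch : Proc → Pred (Sequence N) (suc ℓ)
    AllMatch q s = ∃ λ t → t ∈ LGO N q × AtAll R s t
    EndMatch q s = ∃ λ t → t ∈ LGO N q × AtEnd R s t

    expressible-Local : Expressible (LGO N) AllMatch (Local K)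
    expressible-Local {p} {⟨ X ⟩} (node X≈p []) =
      let χ , χ∈K , p⊨χ , char = characteristic conj p in
      -- `Local` admits a constraint only in conjunction with a formula, hence the added `⊤`.
      χ ∧ ⊤ , local χ∈K top , ∧-intro p⊨χ (λ ()) , λ {r} r⊨ →
      ⟨ L N r ⟩ , node L-refl [] , ⟨ to (adequate X≈p L-refl) (char (r⊨ (lift true))) ⟩
    expressible-Local {p} {X ▷ a ▷ s} (node X≈p ((p′ , p→p′ , s∈) ∷ [])) =
      let χ , χ∈K , p⊨χ , char = characteristic conj p
          φ , φ∈ , p′⊨φ , forces = expressible-Local {s = s} s∈ in
      χ ∧ (a · φ) , local χ∈K (prefix a φ∈) , ∧-intro p⊨χ (p′ , p→p′ , p′⊨φ) , λ {r} r⊨ →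
      let r′ , r→r′ , r′⊨φ = r⊨ (lift false)
          t , t∈ , s~t = forces r′⊨φ in
      (L N r ▷ a ▷ t) , node L-refl ((r′ , r→r′ , t∈) ∷ []) ,
      (to (adequate X≈p L-refl) (char (r⊨ (lift true))) ▷ a ▷ s~t)

    expressible-Final : Expressible (LGO N) EndMatch (Final K)
    expressible-Final {p} {⟨ X ⟩} (node X≈p []) =
      let χ , χ∈K , p⊨χ , char = characteristic conj p in
      χ , final χ∈K , p⊨χ , λ {r} r⊨χ →
      ⟨ L N r ⟩ , node L-refl [] , ⟨ to (adequate X≈p L-refl) (char r⊨χ) ⟩
    expressible-Final {p} {X ▷ a ▷ s} (node X≈p ((p′ , p→p′ , s∈) ∷ [])) =
      let φ , φ∈ , p′⊨φ , forces = expressible-Final {s = s} s∈ in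
      a · φ , prefix a φ∈ , (p′ , p→p′ , p′⊨φ) , λ {r} (r′ , r→r′ , r′⊨φ) →
      let t , t∈ , s~t = forces r′⊨φ in
      (L N r ▷ a ▷ t) , node L-refl ((r′ , r→r′ , t∈) ∷ []) , (a ▷ s~t)

    AtAll⇒⊑ : ∀ {p r s t} → s ∈ LGO N p → t ∈ LGO N r → AtAll R s t → p ⊑[ K ] r
    AtAll⇒⊑ (node X≈p _) (node Y≈r _) ⟨ XRY ⟩       = from (adequate X≈p Y≈r) XRY
    AtAll⇒⊑ (node X≈p _) (node Y≈r _) (XRY ▷ _ ▷ _) = from (adequate X≈p Y≈r) XRY

    approximable-Local : ∀ {φ} → Local K φ → Approximable (LGO N) AllMatch φ
    approximable-Local top {p} _ rs _ = ⟨ L N p ⟩ , node L-refl [] , λ _ _ ()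
    -- The sequence for `φ` works unchanged: its head already records the local observation of `p`,
    -- which by `AtAll⇒⊑` carries `σ` over to every matching process.
    approximable-Local (local σ∈K φ∈) p⊨ rs fin =
      let s , s∈ , sound = approximable-Local φ∈ (p⊨ (lift false)) rs fin in
      s , s∈ , λ { r∈ m@(t , t∈ , s~t) →
        ∧-intro (AtAll⇒⊑ {s = s} {t} s∈ t∈ s~t σ∈K (p⊨ (lift true))) (sound r∈ m) }
    approximable-Local (prefix a φ∈) {p} (p′ , p→p′ , p′⊨φ) rs fin =
      let ss , fin′ , complete = successors rs fin a
          s , s∈ , sound = approximable-Local φ∈ p′⊨φ ss fin′ in
      (L N p ▷ a ▷ s) , node L-refl ((p′ , p→p′ , s∈) ∷ []) ,
      λ { r∈ (_ , node _ ((r′ , r→r′ , t∈) ∷ []) , (_ ▷ _ ▷ s~t)) →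
        r′ , r→r′ , sound (complete r∈ r→r′) (_ , t∈ , s~t) }

    approximable-Final : ∀ {φ} → Final K φ → Approximable (LGO N) EndMatch φ
    approximable-Final top {p} _ rs _ = ⟨ L N p ⟩ , node L-refl [] , λ _ _ ()
    approximable-Final (final σ∈K) {p} p⊨σ rs _ = ⟨ L N p ⟩ , node L-refl [] ,
      λ { _ (_ , node Y≈r _ , ⟨ XRY ⟩) → from (adequate L-refl Y≈r) XRY σ∈K p⊨σ }
    approximable-Final (prefix a φ∈) {p} (p′ , p→p′ , p′⊨φ) rs fin =
      let ss , fin′ , complete = successors rs fin a
          s , s∈ , sound = approximable-Final φ∈ p′⊨φ ss fin′ in
      -- `AtEnd` ignores this label; `L N p` only makes the sequence an observation of `p`.
      (L N p ▷ a ▷ s) , node L-refl ((p′ , p→p′ , s∈) ∷ []) ,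
      λ { r∈ (_ , node _ ((r′ , r→r′ , t∈) ∷ []) , (_ ▷ s~t)) →
        r′ , r→r′ , sound (complete r∈ r→r′) (_ , t∈ , s~t) }

    local-coincides : ∀ {p q} → ImageFinite q → p ⊑[ Local K ] q ⇔ LGO N p ⊆ AllMatch q
    local-coincides = coincide _ _ (λ {_} {s} → expressible-Local {s = s}) approximable-Local

    final-coincides : ∀ {p q} → ImageFinite q → p ⊑[ Final K ] q ⇔ LGO N p ⊆ EndMatch q
    final-coincides = coincide _ _ (λ {_} {s} → expressible-Final {s = s}) approximable-Final

  -- With this closure, matching up to `≈` at every position collapses to the plain membership in
  -- the definition of `≤l`.
  LGO-respects-≈ : ∀ {N q s t} → AtAll _≈_ s t → t ∈ LGO N q → s ∈ LGO N q
  LGO-respects-≈ ⟨ X≈Y ⟩         (node Y≈q []) = node (≈-trans X≈Y Y≈q) []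
  LGO-respects-≈ (X≈Y ▷ a ▷ s~t) (node Y≈q ((q′ , q→q′ , t∈) ∷ [])) =
    node (≈-trans X≈Y Y≈q) ((q′ , q→q′ , LGO-respects-≈ s~t t∈) ∷ [])

  AtAll-refl : ∀ {N q} s → s ∈ LGO N q → AtAll _≈_ s s
  AtAll-refl ⟨ X ⟩       (node X≈q _) = ⟨ ≈-trans X≈q (≈-sym X≈q) ⟩
  AtAll-refl (X ▷ a ▷ s) (node X≈q ((_ , _ , s∈) ∷ [])) =
    ≈-trans X≈q (≈-sym X≈q) ▷ a ▷ AtAll-refl s s∈

  module Linear≡ {N} = Linear {N} {𝓛≡ N} and 𝓛≡-adequate
  module Linear¬ {N} = Linear {N} {𝓛¬ N} and 𝓛¬-adequate

  AllMatch⇔LGO : ∀ {N p q} → LGO N p ⊆ Linear≡.AllMatch q ⇔ p ≤l[ N ] q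
  AllMatch⇔LGO {N} {p} {q} = mk⇔ {A = LGO N p ⊆ Linear≡.AllMatch q} {B = p ≤l[ N ] q}
    (λ p⊆q {s} s∈ → let t , t∈ , s~t = p⊆q {s} s∈ in LGO-respects-≈ s~t t∈)
    (λ p≤q {s} s∈ → s , p≤q {s} s∈ , AtAll-refl s (p≤q {s} s∈))

  -- Branching semantics

  module Branching (N : Constraint) where

    Arc : Set (suc ℓ)
    Arc = Act × Tree N

    ArcOf : Proc → Pred Arc (suc ℓ)
    ArcOf p (a , t) = ∃ λ p′ → p -[ a ]→ p′ × t ∈ BGO N p′

    Forces : Logic → Proc → Arc → Form → Set (suc ℓ)
    Forces K p (a , t) φ = K φ × p ⊨ a · φ × (∀ {r} → r ⊨ φ → t ∈ BGO N r)

    𝓛≡⊆𝓛-NS : 𝓛≡ N ⊆ 𝓛-NS N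
    𝓛≡⊆𝓛-NS (pos σ∈N) = pos σ∈N
    𝓛≡⊆𝓛-NS (neg σ∈N) = neg σ∈N
    𝓛≡⊆𝓛-NS (and φ∈)  = and (𝓛≡⊆𝓛-NS ∘ φ∈)

    ∧-closed : ∀ {φ ψ} → 𝓛-NS N φ → 𝓛-NS N ψ → 𝓛-NS N (φ ∧ ψ)
    ∧-closed φ∈ ψ∈ = and λ { (lift true) → φ∈ ; (lift false) → ψ∈ }

    BGO-characteristic : ∀ {p l} → l ≈ L N p →
      ∃ λ χ → 𝓛≡ N χ × p ⊨ χ × (∀ {r} → r ⊨ χ → l ≈ L N r)
    BGO-characteristic {p} l≈p =
      let χ , χ∈ , p⊨χ , char = characteristic and p in
      χ , χ∈ , p⊨χ , λ r⊨χ → to (𝓛≡-adequate l≈p L-refl) (char r⊨χ)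

    mutual

      expressible-NS : Expressible (BGO N) (BGO N) (𝓛-NS N)
      expressible-NS (node l≈p arcs∈) =
        let χ , χ∈ , p⊨χ , forces-l = BGO-characteristic l≈p
            φ , φ∈ , p⊨φ , forces-arcs = expressible-arcs arcs∈ in
        χ ∧ φ , ∧-closed (𝓛≡⊆𝓛-NS χ∈) φ∈ , ∧-intro p⊨χ p⊨φ , λ r⊨ →
        node (forces-l (r⊨ (lift true))) (forces-arcs (r⊨ (lift false)))

      expressible-arcs : ∀ {p arcs} → All (ArcOf p) arcs →
        ∃ λ φ → 𝓛-NS N φ × p ⊨ φ × (∀ {r} → r ⊨ φ → All (ArcOf r) arcs)
      expressible-arcs [] = ⊤ , and (λ ()) , (λ ()) , λ _ → []
      expressible-arcs {arcs = (a , _) ∷ _} ((p′ , p→p′ , t∈) ∷ arcs∈) =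
        let φ , φ∈ , p′⊨φ , forces-t = expressible-NS t∈
            ψ , ψ∈ , p⊨ψ , forces-arcs = expressible-arcs arcs∈ in
        (a · φ) ∧ ψ , ∧-closed (prefix a φ∈) ψ∈ , ∧-intro (p′ , p→p′ , p′⊨φ) p⊨ψ , λ r⊨ →
        let r′ , r→r′ , r′⊨φ = r⊨ (lift true) in
        (r′ , r→r′ , forces-t r′⊨φ) ∷ forces-arcs (r⊨ (lift false))

    -- Both root labels are equivalent to `L N p`, so all the arcs can hang from a single root. The
    -- result may repeat actions, so it need not be deterministic even if both trees are.
    BGO-merge : ∀ {p t u} → t ∈ BGO N p → u ∈ BGO N p →
      ∃ λ v → v ∈ BGO N p × (∀ {r} → v ∈ BGO N r → t ∈ BGO N r × u ∈ BGO N r)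
    BGO-merge {t = node l arcs} {node m arcs′} (node l≈p arcs∈) (node m≈p arcs′∈) =
      node l (arcs ++ arcs′) , node l≈p (All.++⁺ arcs∈ arcs′∈) , λ
        { (node l≈r ∈r) →
            node l≈r (All.++⁻ˡ arcs ∈r) ,
            node (≈-trans m≈p (≈-trans (≈-sym l≈p) l≈r)) (All.++⁻ʳ arcs ∈r) }

    approximable-NS : ∀ {φ} → 𝓛-NS N φ → Approximable (BGO N) (BGO N) φ
    approximable-NS (pos σ∈N) {p} p⊨σ rs _ = node (L N p) [] , node L-refl [] ,
      λ { _ (node p≈r _) → from (𝓛≡-adequate L-refl L-refl) p≈r (pos σ∈N) p⊨σ }
    approximable-NS (neg σ∈N) {p} p⊭σ rs _ = node (L N p) [] , node L-refl [] ,
      λ { _ (node p≈r _) → from (𝓛≡-adequate L-refl L-refl) p≈r (neg σ∈N) p⊭σ }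
    approximable-NS (and {φ = φ} φ∈) {p} p⊨φ rs fin =
      let js , enough = finiteSubconjunction φ rs
          t , t∈ , sound = conjuncts js in
      t , t∈ , λ r∈ t∈r → enough r∈ (sound r∈ t∈r)
      where
      -- Merging one tree per conjunct gives a tree sound for all of them; the bare root serves the
      -- empty list.
      conjuncts : ∀ js → ∃ λ t → t ∈ BGO N p ×
                  (∀ {r} → r ∈ˡ rs → t ∈ BGO N r → ∀ {j} → j ∈ˡ js → r ⊨ φ j)
      conjuncts []       = node (L N p) [] , node L-refl [] , λ _ _ ()
      conjuncts (j ∷ js) =
        let t , t∈ , sound-j  = approximable-NS (φ∈ j) (p⊨φ j) rs fin
            u , u∈ , sound-js = conjuncts js
            v , v∈ , split    = BGO-merge t∈ u∈ in
        v , v∈ , λ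
          { r∈ v∈r (here refl) → sound-j r∈ (proj₁ (split v∈r))
          ; r∈ v∈r (there j∈)  → sound-js r∈ (proj₂ (split v∈r)) j∈ }
    approximable-NS (prefix a φ∈) {p} (p′ , p→p′ , p′⊨φ) rs fin =
      let ss , fin′ , complete = successors rs fin a
          t , t∈ , sound = approximable-NS φ∈ p′⊨φ ss fin′ in
      node (L N p) ((a , t) ∷ []) , node L-refl ((p′ , p→p′ , t∈) ∷ []) ,
      λ { r∈ (node _ ((r′ , r→r′ , t∈r′) ∷ [])) →
        r′ , r→r′ , sound (complete r∈ r→r′) t∈r′ }

    -- Distinct arcs have distinct actions, so a choice for each arc is a
    -- function of its action, as the index of `branch` requires.
    choose-by-action : ∀ {b q} {B : Set b} {Q : Arc → B → Set q} → B → ∀ {arcs} →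
      Unique (map proj₁ arcs) → All (λ arc → ∃ (Q arc)) arcs →
      ∃ λ (f : Act → B) → All (λ arc → Q arc (f (proj₁ arc))) arcs
    choose-by-action default [] [] = (λ _ → default) , []
    choose-by-action {B = B} {Q} default {(a , t) ∷ arcs} (a∉ ∷ uniq) ((x , Qx) ∷ Qs) =
      f , Q-head ∷ All.tabulate λ {arc} arc∈ →
        Q-tail arc (All.lookup (All.map⁻ a∉) arc∈) (All.lookup (proj₂ rest) arc∈)
      where
      rest = choose-by-action {Q = Q} default uniq Qs
      f : Act → B
      f b with em {P = a ≡ b}
      ... | yes _ = x
      ... | no  _ = proj₁ rest b
      Q-head : Q (a , t) (f a)
      Q-head with em {P = a ≡ a}
      ... | yes _   = Qx
      ... | no  a≢a = contradiction refl a≢a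
      Q-tail : ∀ arc → Not (a ≡ proj₁ arc) → Q arc (proj₁ rest (proj₁ arc)) → Q arc (f (proj₁ arc))
      Q-tail (b , _) a≢b Qb with em {P = a ≡ b}
      ... | yes a≡b = contradiction a≡b a≢b
      ... | no  _   = Qb

    mutual

      expressible-D : Expressible (dBGO N) (BGO N) (𝓛-D N)
      expressible-D (node {p} {l} {arcs} l≈p arcs∈ , node uniq det) =
        let χ , χ∈ , p⊨χ , forces-l = BGO-characteristic l≈p
            f , good = choose-by-action {Q = Forces (𝓛-D N) p} ⊤ uniq (forcing-arcs arcs∈ det)
            -- `X` collects the labels of the arcs; `at` turns a property of labels, proved arc by
            -- arc, into one of the members of `X`.
            X : Pred Act ℓ
            X a = a ∈ˡ map proj₁ arcs
            at : ∀ {c} {P : Pred Act c} → All (P ∘ proj₁) arcs → ∀ a → X a → P a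
            at all a a∈ = All.lookup (All.map⁺ all) a∈
        in
        χ ∧ ⋀ (λ (x : Σ Act X) → proj₁ x · f (proj₁ x)) ,
        local χ∈ (branch X f (at (All.map proj₁ good))) ,
        ∧-intro p⊨χ (λ (a , a∈) → at (All.map (proj₁ ∘ proj₂) good) a a∈) ,
        λ r⊨ → node (forces-l (r⊨ (lift true))) (All.tabulate λ {arc} arc∈ →
          let r′ , r→r′ , r′⊨ = r⊨ (lift false) (proj₁ arc , ∈-map⁺ proj₁ arc∈) in
          r′ , r→r′ , proj₂ (proj₂ (All.lookup good arc∈)) r′⊨)

      forcing-arcs : ∀ {p arcs} → All (ArcOf p) arcs → All ((_∈ Deterministic) ∘ proj₂) arcs →
                     All (λ arc → ∃ (Forces (𝓛-D N) p arc)) arcs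
      forcing-arcs []                        []          = []
      forcing-arcs ((p′ , p→p′ , t∈) ∷ arcs∈) (dt ∷ det) =
        (let φ , φ∈ , p′⊨φ , forces = expressible-D (t∈ , dt) in
         φ , φ∈ , (p′ , p→p′ , p′⊨φ) , forces) ∷ forcing-arcs arcs∈ det

    -- The witness given by `g` may vary with the proof of `a ∈ X`; excluded middle fixes one proof
    -- per action. The default fills in outside `X`.
    choose-on : ∀ {b q} {B : Set b} {Q : Act → B → Set q} (X : Pred Act ℓ) → B →
      (∀ a → a ∈ X → ∃ (Q a)) → ∃ λ (f : Act → B) → ∀ a → a ∈ X → Q a (f a)
    choose-on {B = B} {Q} X default g = proj₁ ∘ h , proj₂ ∘ h
      where
      h : ∀ a → ∃ λ b → a ∈ X → Q a b
      h a with em {P = a ∈ X}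
      ... | yes a∈X = proj₁ (g a a∈X) , λ _ → proj₂ (g a a∈X)
      ... | no  a∉X = default , λ a∈X → contradiction a∈X a∉X

    approximable-D : ∀ {φ} → 𝓛-D N φ → Approximable (dBGO N) (BGO N) φ
    approximable-D top {p} _ rs _ =
      node (L N p) [] , (node L-refl [] , node [] []) , λ _ _ ()
    -- The root of the tree for `φ` already carries the observation of `p`, so the same tree also
    -- guarantees `σ`.
    approximable-D (local σ∈ φ∈) p⊨ rs fin
      with approximable-D φ∈ (p⊨ (lift false)) rs fin
    ... | t , t∈@(node l≈p _ , _) , sound = t , t∈ , λ
      { r∈ t∈r@(node l≈r _) →
        ∧-intro (from (𝓛≡-adequate L-refl L-refl) (≈-trans (≈-sym l≈p) l≈r) σ∈ (p⊨ (lift true)))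
                (sound r∈ t∈r) }
    approximable-D (branch X φ φ∈) {p} p⊨ rs fin =
      let js , enough = finiteSubconjunction (λ (x : Σ Act X) → proj₁ x · φ (proj₁ x)) rs
          -- Several indices in `js` may share an action. Keeping each action once makes the tree
          -- deterministic, and loses no conjunct since `φ` depends on the action alone.
          as = deduplicate _≟_ (map proj₁ js)
          f , good = choose-on X (node (L N p) []) approximate
          arcs = map (λ a → a , f a) as
          as⊆X : ∀ {a} → a ∈ˡ as → a ∈ X
          as⊆X a∈ = let x , _ , a≡x = ∈-map⁻ proj₁ (∈-deduplicate⁻ _≟_ (map proj₁ js) a∈) in
                    subst (_∈ X) (sym a≡x) (proj₂ x)
          goods : All (λ a → Good a (f a)) as
          goods = All.tabulate λ a∈ → good _ (as⊆X a∈)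
      in
      node (L N p) arcs ,
      ( node L-refl (All.map⁺ (All.map proj₁ goods))
      , node (subst Unique (sym (trans (sym (map-∘ as)) (map-id as))) (deduplicate-! _≟_ (map proj₁ js)))
             (All.map⁺ (All.map (proj₁ ∘ proj₂) goods)) ) ,
      λ { r∈ (node _ arcs∈) → enough r∈ λ {x} x∈ →
        let a∈ = ∈-deduplicate⁺ _≟_ (∈-map⁺ proj₁ x∈) in
        proj₂ (proj₂ (All.lookup goods a∈)) r∈ (All.lookup (All.map⁻ arcs∈) a∈) }
      where
      _≟_ : (a b : Act) → Dec (a ≡ b)
      a ≟ b = em
      Good : Act → Tree N → Set (suc ℓ)
      Good a t = ArcOf p (a , t) × t ∈ Deterministic ×
                 (∀ {r} → r ∈ˡ rs → ArcOf r (a , t) → r ⊨ a · φ a)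
      approximate : ∀ a → a ∈ X → ∃ (Good a)
      approximate a a∈X =
        let p′ , p→p′ , p′⊨φ = p⊨ (a , a∈X)
            ss , fin′ , complete = successors rs fin a
            t , (t∈ , det) , sound = approximable-D (φ∈ a a∈X) p′⊨φ ss fin′ in
        t , (p′ , p→p′ , t∈) , det ,
        λ { r∈ (r′ , r→r′ , t∈r′) → r′ , r→r′ , sound (complete r∈ r→r′) t∈r′ }

    ns-coincides : ∀ {p q} → ImageFinite q → p ⊑[ 𝓛-NS N ] q ⇔ BGO N p ⊆ BGO N q
    ns-coincides = coincide _ _ expressible-NS approximable-NS

    -- Determinism belongs to the tree and not to the process, so an inclusion of `dBGO N p` in
    -- `BGO N q` is already one in `dBGO N q`.
    d-coincides : ∀ {p q} → ImageFinite q → p ⊑[ 𝓛-D N ] q ⇔ dBGO N p ⊆ dBGO N q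
    d-coincides {p} {q} fin =
      mk⇔ {A = dBGO N p ⊆ BGO N q} {B = dBGO N p ⊆ dBGO N q}
          (λ p⊆q {_} t∈ → p⊆q t∈ , proj₂ t∈) (λ p⊆q {_} t∈ → proj₁ (p⊆q t∈))
      ⇔-∘ coincide _ _ expressible-D approximable-D fin

theorem7 : (em : ∀ {a : Level} → ExcludedMiddle a) →
    ∀ {ℓ : Level} (lts : LTS ℓ) → let open Semantics lts in
    ∀ (N : Constraint) {p q : Proc} → ImageFinite p → ImageFinite q →
    (p ⊑[ 𝓛-NS N ] q ⇔ BGO N p ⊆ BGO N q)
    × (p ⊑[ 𝓛-l N ] q ⇔ p ≤l[ N ] q)
    × (p ⊑[ 𝓛-l⊇ N ] q ⇔ p ≤l⊇[ N ] q)
    × (p ⊑[ 𝓛-lf N ] q ⇔ p ≤lf[ N ] q)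
    × (p ⊑[ 𝓛-lf⊇ N ] q ⇔ p ≤lf⊇[ N ] q)
    × (p ⊑[ 𝓛-D N ] q ⇔ dBGO N p ⊆ dBGO N q)
theorem7 em lts N _ q-fin =
    ns-coincides q-fin
  , (AllMatch⇔LGO ⇔-∘ Linear≡.local-coincides q-fin)
  , Linear¬.local-coincides q-fin
  , Linear≡.final-coincides q-fin
  , Linear¬.final-coincides q-fin
  , d-coincides q-fin
  where
  open Coincidence em lts
  open Branching N
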